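{- Let $n\geq 2$ and $p\in\mathbb{Z}^{+}$, and let $A=(a_1,a_2,\ldots,a_n)$ be a sequence of positive integers with $\gcd(a_1,\ldots,a_n)=1$ such that, for each $1\leq i\leq n$, $a_i=pk_i+t_i$ with $k_i\in\mathbb{N}$ and $t_i$ an integer satisfying $1\leq t_i\leq p-1$. Let $$\mathcal{T}_p=\left\{(x_1,x_2,\ldots,x_n)\in\mathbb{Z}^n \;\Big|\; 0\leq x_1,x_2,\ldots,x_n\leq p-1,\ \ p\ \Big|\ \sum_{i=1}^n x_it_i,\ \ \sum_{i=1}^n x_it_i\neq 0\right\}.$$ Then $$\frac{\langle A\rangle}{p}=\left\langle a_1,a_2,\ldots,a_n,\ \frac{1}{p}\sum_{i=1}^n x_ia_i\ \Big|\ (x_1,x_2,\ldots,x_n)\in\mathcal{T}_p\right\rangle,$$ i.e. the elements $a_1,\ldots,a_n$ together with all the elements $\frac1p\sum_{i=1}^n x_ia_i$ for $(x_1,\ldots,x_n)\in\mathcal{T}_p$ form a system of generators of the quotient of the numerical semigroup $\langle A\rangle$ by $p$.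
   Context: $\mathbb{N}$ denotes the non-negative integers and $\mathbb{Z}^{+}$ the positive integers. For a collection of positive integers, $\langle\,\cdot\,\rangle$ denotes the set of all finite linear combinations of its elements with coefficients in $\mathbb{N}$ (the submonoid of $(\mathbb{N},+)$ generated by them); these elements are then called a system of generators of that set (not necessarily minimal). In particular $\langle A\rangle=\{x_1a_1+\cdots+x_na_n\mid x_i\in\mathbb{N}\}$. The quotient of $\langle A\rangle$ by $p\in\mathbb{Z}^+$ is $\frac{\langle A\rangle}{p}=\{m\in\mathbb{N}\mid pm\in\langle A\rangle\}$. -}

module Defs where

open import Level using (Level; 0ℓ)
open import Data.Nat.Base as ℕ using (ℕ)
import Data.Nat.Properties as ℕ
open import Data.Nat.GCD using (gcd)
open import Data.Integer.Base using (ℤ; +_; _*_; _-_; _≤_; 0ℤ; 1ℤ)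
import Data.Integer.Properties as ℤ
open import Data.Integer.Divisibility.Signed using (_∣_)
open import Data.Product.Base using (∃-syntax; Σ-syntax; _×_)
open import Data.Vec.Functional using (Vector; foldr)
open import Relation.Binary.PropositionalEquality using (_≡_; _≢_)
open import Relation.Unary using (Pred; _∈_)
open import Algebra.Properties.CommutativeMonoid.Sum ℕ.+-0-commutativeMonoid public
  using () renaming (sum to sumℕ)
open import Algebra.Properties.CommutativeMonoid.Sum ℤ.+-0-commutativeMonoid public
  using () renaming (sum to sumℤ)

private
  variable
    ℓ : Level
    n : ℕ

-- gcd 0 m = m, so starting from 0 is harmless.
gcdᵛ : Vector ℕ n → ℕ
gcdᵛ = foldr gcd 0

Entries : Vector ℕ n → Pred ℕ 0ℓ
Entries a m = ∃[ i ] m ≡ a i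

-- All finite ℕ-linear combinations of elements of S; the elements g i need not
-- be distinct, and r = 0 gives the empty combination 0.
⟨_⟩ : Pred ℕ ℓ → Pred ℕ ℓ
⟨ S ⟩ m =
  Σ[ r ∈ ℕ ] Σ[ c ∈ Vector ℕ r ] Σ[ g ∈ Vector ℕ r ]
    (∀ i → g i ∈ S) × m ≡ sumℕ (λ i → c i ℕ.* g i)

infixl 7 _÷_

_÷_ : Pred ℕ ℓ → ℕ → Pred ℕ ℓ
(M ÷ p) m = p ℕ.* m ∈ M

𝒯 : ℕ → Vector ℤ n → Pred (Vector ℤ n) 0ℓ
𝒯 p t x =
    (∀ i → 0ℤ ≤ x i × x i ≤ + p - 1ℤ)
  × + p ∣ sumℤ (λ i → x i * t i)
  × sumℤ (λ i → x i * t i) ≢ 0ℤ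

-- The numbers (1/p) ∑ xᵢaᵢ for x in 𝒯 p t, with g = (1/p) s written as p g = s.
-- When aᵢ = p kᵢ + tᵢ, p divides ∑ xᵢaᵢ because it divides ∑ xᵢtᵢ, so each x in
-- 𝒯 p t contributes exactly one number (for p > 0).
Fractions : ℕ → Vector ℕ n → Vector ℤ n → Pred ℕ 0ℓ
Fractions p a t g =
  ∃[ x ] x ∈ 𝒯 p t × + p * + g ≡ sumℤ (λ i → x i * + a i)

{-# OPTIONS --safe #-}

-- Divide each coefficient by p with remainder: if p m = ∑ Xᵢaᵢ with
-- Xᵢ = qᵢ p + xᵢ, then m = ∑ qᵢaᵢ + (1/p) ∑ xᵢaᵢ.  Since aᵢ ≡ tᵢ mod p, either x
-- lies in 𝒯 p t or ∑ xᵢtᵢ = 0; in the latter case x = 0 because every tᵢ is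
-- positive.  Conversely, the quotient is a submonoid containing every generator.
module Submission where

open import Defs
open import Data.Fin.Base using (Fin; zero; suc)
open import Data.Integer.Base using (ℤ; +_; _+_; _*_; _-_; _≤_; 0ℤ; 1ℤ; ∣_∣; +≤+)
import Data.Integer.Divisibility.Signed as ℤ∣
import Data.Integer.Properties as ℤ
import Data.Integer.Tactic.RingSolver as ℤ-Solver
open import Data.Nat.Base as ℕ using (ℕ; zero; suc; z≤n; s≤s)
import Data.Nat.Divisibility as ℕ∣
open import Data.Nat.DivMod using (_/_; _%_; m%n<n; m≡m%n+[m/n]*n)
import Data.Nat.Properties as ℕ
import Data.Nat.Tactic.RingSolver as ℕ-Solver
open import Data.Product.Base using (_×_; _,_; Σ-syntax; proj₁; proj₂)
open import Data.Sum.Base using (inj₁; inj₂; [_,_])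
open import Data.Vec.Functional using (Vector; _∷_)
open import Level using (Level; 0ℓ)
open import Relation.Binary.PropositionalEquality
  using (_≡_; refl; sym; trans; cong; cong₂; subst; module ≡-Reasoning)
open import Relation.Nullary using (yes; no)
open import Relation.Unary using (Pred; _∈_; _⊆_; _∪_; _≐_)
open import Algebra.Properties.Semiring.Sum ℕ.+-*-semiring
  using () renaming (sum-cong-≗ to sumℕ-cong; sum-replicate-zero to sumℕ-zero;
                     ∑-distrib-+ to sumℕ-+; *-distribˡ-sum to *-distribˡ-sumℕ)
open import Algebra.Properties.Semiring.Sum ℤ.+-*-semiring
  using () renaming (sum-cong-≗ to sumℤ-cong; ∑-distrib-+ to sumℤ-+;
                     *-distribˡ-sum to *-distribˡ-sumℤ)

open ≡-Reasoning

private
  variable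
    ℓ : Level
    n : ℕ
    P : Pred ℕ ℓ

-- Submonoids of the natural numbers and their generators

record IsSubmonoid (P : Pred ℕ ℓ) : Set ℓ where
  field
    0-closed : 0 ∈ P
    +-closed : ∀ {m n} → m ∈ P → n ∈ P → m ℕ.+ n ∈ P

  *-closed : ∀ c {m} → m ∈ P → c ℕ.* m ∈ P
  *-closed zero    m∈P = 0-closed
  *-closed (suc c) m∈P = +-closed m∈P (*-closed c m∈P)

  sum-closed : (f : Vector ℕ n) → (∀ i → f i ∈ P) → sumℕ f ∈ P
  sum-closed {n = zero}  f f∈P = 0-closed
  sum-closed {n = suc n} f f∈P =
    +-closed (f∈P zero) (sum-closed (λ i → f (suc i)) (λ i → f∈P (suc i)))

open IsSubmonoid

⟨⟩-minimal : (S : Pred ℕ ℓ) → IsSubmonoid P → S ⊆ P → ⟨ S ⟩ ⊆ P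
⟨⟩-minimal S P-sub S⊆P (r , c , g , g∈S , refl) =
  sum-closed P-sub _ (λ i → *-closed P-sub (c i) (S⊆P (g∈S i)))

-- Prepending one entry to both vectors makes the new sum unfold definitionally to the head term
-- plus the old sum, hence the final `refl`.
⟨⟩-cons : ∀ (S : Pred ℕ ℓ) c {g m} → g ∈ S → m ∈ ⟨ S ⟩ → c ℕ.* g ℕ.+ m ∈ ⟨ S ⟩
⟨⟩-cons S c {g} g∈S (r , cs , gs , gs∈S , refl) =
  suc r , c ∷ cs , g ∷ gs , (λ { zero → g∈S ; (suc i) → gs∈S i }) , refl

⟨⟩-isSubmonoid : (S : Pred ℕ ℓ) → IsSubmonoid ⟨ S ⟩
⟨⟩-isSubmonoid S .0-closed = 0 , (λ ()) , (λ ()) , (λ ()) , refl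
⟨⟩-isSubmonoid S .+-closed {n = m′} (r , c , g , g∈S , refl) m′∈ = go r c g g∈S
  where
  -- The terms of the first combination are moved one at a time onto the second, which avoids sums
  -- over concatenated vectors.
  go : ∀ r (c g : Vector ℕ r) → (∀ i → g i ∈ S) →
       sumℕ (λ i → c i ℕ.* g i) ℕ.+ m′ ∈ ⟨ S ⟩
  go zero    c g g∈S = m′∈
  go (suc r) c g g∈S =
    subst ⟨ S ⟩ (sym (ℕ.+-assoc (c zero ℕ.* g zero) _ m′))
      (⟨⟩-cons S (c zero) (g∈S zero)
        (go r (λ i → c (suc i)) (λ i → g (suc i)) (λ i → g∈S (suc i))))

⟨⟩-generator : (S : Pred ℕ ℓ) → S ⊆ ⟨ S ⟩
⟨⟩-generator S {g} g∈S =
  subst ⟨ S ⟩ (trans (ℕ.+-identityʳ _) (ℕ.*-identityˡ g))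
    (⟨⟩-cons S 1 g∈S (⟨⟩-isSubmonoid S .0-closed))

÷-isSubmonoid : ∀ p → IsSubmonoid P → IsSubmonoid (P ÷ p)
÷-isSubmonoid {P = P} p P-sub .0-closed =
  subst P (sym (ℕ.*-zeroʳ p)) (P-sub .0-closed)
÷-isSubmonoid {P = P} p P-sub .+-closed {m} {m′} m∈ m′∈ =
  subst P (sym (ℕ.*-distribˡ-+ p m m′)) (P-sub .+-closed m∈ m′∈)

-- A member of `⟨ Entries a ⟩` may list the entries in any order and with repetitions. Here each
-- index has exactly one coefficient, the form in which coefficients can be divided by `p`.
Combination : Vector ℕ n → Pred ℕ 0ℓ
Combination {n} a m = Σ[ X ∈ Vector ℕ n ] m ≡ sumℕ (λ i → X i ℕ.* a i)

Combination-isSubmonoid : (a : Vector ℕ n) → IsSubmonoid (Combination a)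
Combination-isSubmonoid {n} a .0-closed = (λ _ → 0) , sym (sumℕ-zero n)
Combination-isSubmonoid a .+-closed (X , refl) (Y , refl) =
  (λ i → X i ℕ.+ Y i) ,
  sym (trans (sumℕ-cong (λ i → ℕ.*-distribʳ-+ (a i) (X i) (Y i)))
             (sumℕ-+ (λ i → X i ℕ.* a i) (λ i → Y i ℕ.* a i)))

entry-Combination : (a : Vector ℕ n) (i : Fin n) → a i ∈ Combination a
entry-Combination {suc n} a zero =
  1 ∷ (λ _ → 0) ,
  sym (trans (cong₂ ℕ._+_ (ℕ.*-identityˡ (a zero)) (sumℕ-zero n)) (ℕ.+-identityʳ _))
entry-Combination {suc n} a (suc i)
  with X , eq ← entry-Combination (λ j → a (suc j)) i = 0 ∷ X , eq

⟨Entries⟩⊆Combination : (a : Vector ℕ n) → ⟨ Entries a ⟩ ⊆ Combination a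
⟨Entries⟩⊆Combination a =
  ⟨⟩-minimal (Entries a) (Combination-isSubmonoid a) λ { (i , refl) → entry-Combination a i }

-- Sums in ℕ and ℤ, and reduction modulo p

pos-sum : (f : Vector ℕ n) → + sumℕ f ≡ sumℤ (λ i → + f i)
pos-sum {zero}  f = refl
pos-sum {suc n} f = begin
  + (f zero ℕ.+ sumℕ (λ i → f (suc i)))         ≡⟨ ℤ.pos-+ (f zero) _ ⟩
  (+ f zero) + (+ sumℕ (λ i → f (suc i)))       ≡⟨ cong (λ s → (+ f zero) + s) (pos-sum (λ i → f (suc i))) ⟩
  (+ f zero) + sumℤ (λ i → + f (suc i))         ∎

pos-sum-* : (f g : Vector ℕ n) →
            + sumℕ (λ i → f i ℕ.* g i) ≡ sumℤ (λ i → + f i * + g i)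
pos-sum-* f g = trans (pos-sum (λ i → f i ℕ.* g i)) (sumℤ-cong (λ i → ℤ.pos-* (f i) (g i)))

sum≡0⇒≡0 : (f : Vector ℕ n) → sumℕ f ≡ 0 → ∀ i → f i ≡ 0
sum≡0⇒≡0 f eq zero    = ℕ.m+n≡0⇒m≡0 (f zero) eq
sum≡0⇒≡0 f eq (suc i) =
  sum≡0⇒≡0 (λ j → f (suc j)) (ℕ.m+n≡0⇒n≡0 (f zero) eq) i

-- All terms are non-negative, so the sum vanishes only if each term does, and the nonzero factor
-- `t i` then cancels. Passing to absolute values moves the argument to ℕ.
sum*pos≡0⇒≡0 : (x : Vector ℕ n) (t : Vector ℤ n) → (∀ i → 1ℤ ≤ t i) →
               sumℤ (λ i → + x i * t i) ≡ 0ℤ → ∀ i → x i ≡ 0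
sum*pos≡0⇒≡0 x t 1≤t eq i =
  ℕ.m*n≡0⇒m≡0 (x i) ∣ t i ∣ {{∣t∣-nonZero}} (sum≡0⇒≡0 (λ j → x j ℕ.* ∣ t j ∣) sumℕ≡0 i)
  where
  ∣t∣-nonZero : ℕ.NonZero ∣ t i ∣
  -- Matching on `+≤+` forces `t i` to be the image of a natural number that is at least 1.
  ∣t∣-nonZero with t i | 1≤t i
  ... | _ | +≤+ 1≤∣t∣ = ℕ.>-nonZero 1≤∣t∣

  +∣t∣ : ∀ j → + ∣ t j ∣ ≡ t j
  +∣t∣ j = ℤ.0≤i⇒+∣i∣≡i (ℤ.≤-trans (+≤+ z≤n) (1≤t j))

  sumℕ≡0 : sumℕ (λ j → x j ℕ.* ∣ t j ∣) ≡ 0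
  sumℕ≡0 = ℤ.+-injective (begin
    + sumℕ (λ j → x j ℕ.* ∣ t j ∣)    ≡⟨ pos-sum-* x (λ j → ∣ t j ∣) ⟩
    sumℤ (λ j → + x j * + ∣ t j ∣)    ≡⟨ sumℤ-cong (λ j → cong (+ x j *_) (+∣t∣ j)) ⟩
    sumℤ (λ j → + x j * t j)          ≡⟨ eq ⟩
    0ℤ                                ∎)

-- Gives the congruence of the sums of `x i * a i` and `x i * t i` modulo `p`, with the explicit
-- multiple of `p` by which they differ.
sum-residues : ∀ (p : ℤ) (x a k t : Vector ℤ n) → (∀ i → a i ≡ p * k i + t i) →
  sumℤ (λ i → x i * a i) ≡ p * sumℤ (λ i → x i * k i) + sumℤ (λ i → x i * t i)
sum-residues p x a k t a≡ = begin
  sumℤ (λ i → x i * a i)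
    ≡⟨ sumℤ-cong (λ i → trans (cong (x i *_) (a≡ i)) (rearrange (x i) p (k i) (t i))) ⟩
  sumℤ (λ i → p * (x i * k i) + x i * t i)
    ≡⟨ sumℤ-+ (λ i → p * (x i * k i)) (λ i → x i * t i) ⟩
  sumℤ (λ i → p * (x i * k i)) + sumℤ (λ i → x i * t i)
    ≡⟨ cong (_+ _) (*-distribˡ-sumℤ p (λ i → x i * k i)) ⟨
  p * sumℤ (λ i → x i * k i) + sumℤ (λ i → x i * t i) ∎
  where
  rearrange : ∀ x p k t → x * (p * k + t) ≡ p * (x * k) + x * t
  rearrange = ℤ-Solver.solve-∀

sum-divMod : ∀ p .{{_ : ℕ.NonZero p}} (X a : Vector ℕ n) →
  sumℕ (λ i → X i ℕ.* a i) ≡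
  p ℕ.* sumℕ (λ i → X i / p ℕ.* a i) ℕ.+ sumℕ (λ i → X i % p ℕ.* a i)
sum-divMod p X a = begin
  sumℕ (λ i → X i ℕ.* a i)
    ≡⟨ sumℕ-cong (λ i → trans (cong (ℕ._* a i) (m≡m%n+[m/n]*n (X i) p))
                              (rearrange (X i % p) (X i / p) p (a i))) ⟩
  sumℕ (λ i → p ℕ.* (X i / p ℕ.* a i) ℕ.+ X i % p ℕ.* a i)
    ≡⟨ sumℕ-+ (λ i → p ℕ.* (X i / p ℕ.* a i)) (λ i → X i % p ℕ.* a i) ⟩
  sumℕ (λ i → p ℕ.* (X i / p ℕ.* a i)) ℕ.+ sumℕ (λ i → X i % p ℕ.* a i)
    ≡⟨ cong (ℕ._+ sumℕ (λ i → X i % p ℕ.* a i)) (*-distribˡ-sumℕ p (λ i → X i / p ℕ.* a i)) ⟨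
  p ℕ.* sumℕ (λ i → X i / p ℕ.* a i) ℕ.+ sumℕ (λ i → X i % p ℕ.* a i) ∎
  where
  rearrange : ∀ x q p a → (x ℕ.+ q ℕ.* p) ℕ.* a ≡ p ℕ.* (q ℕ.* a) ℕ.+ x ℕ.* a
  rearrange = ℕ-Solver.solve-∀

<⇒pos≤pos-1 : ∀ {x p} → x ℕ.< p → + x ≤ + p - 1ℤ
-- Matching on `s≤s` exposes the bound as a successor, so that subtracting `1ℤ` computes.
<⇒pos≤pos-1 (s≤s x≤p) = +≤+ x≤p

-- The quotient lies in the generated submonoid

module _ (p : ℕ) .{{_ : ℕ.NonZero p}} (a k : Vector ℕ n) (t : Vector ℤ n)
         (a≡pk+t : ∀ i → + a i ≡ + p * + k i + t i) (1≤t : ∀ i → 1ℤ ≤ t i)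
  where

  private
    S = Entries a ∪ Fractions p a t

  remainder∈⟨⟩ : ∀ (x : Vector ℕ n) g → (∀ i → x i ℕ.< p) →
    p ℕ.* g ≡ sumℕ (λ i → x i ℕ.* a i) → g ∈ ⟨ S ⟩
  remainder∈⟨⟩ x g x<p pg≡ with sumℤ (λ i → + x i * t i) ℤ.≟ 0ℤ
  -- All remainders vanish, so `g` is 0, the empty combination.
  ... | yes ∑xt≡0 =
    subst ⟨ S ⟩ (sym g≡0) (⟨⟩-isSubmonoid S .0-closed)
    where
    x≡0 : ∀ i → x i ≡ 0
    x≡0 = sum*pos≡0⇒≡0 x t 1≤t ∑xt≡0

    g≡0 : g ≡ 0
    g≡0 = ℕ.*-cancelˡ-≡ g 0 p (begin
      p ℕ.* g                     ≡⟨ pg≡ ⟩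
      sumℕ (λ i → x i ℕ.* a i)    ≡⟨ sumℕ-cong (λ i → cong (ℕ._* a i) (x≡0 i)) ⟩
      sumℕ {n = n} (λ _ → 0)      ≡⟨ sumℕ-zero n ⟩
      0                           ≡⟨ ℕ.*-zeroʳ p ⟨
      p ℕ.* 0                     ∎)
  -- The remainders themselves are the point of `𝒯 p t`, and `g` is the fraction they define.
  ... | no ∑xt≢0 =
    ⟨⟩-generator S (inj₂ ((λ i → + x i) ,
      ((λ i → +≤+ z≤n , <⇒pos≤pos-1 (x<p i)) , p∣∑xt , ∑xt≢0) , pg≡ℤ))
    where
    pg≡ℤ : + p * + g ≡ sumℤ (λ i → + x i * + a i)
    pg≡ℤ = trans (sym (ℤ.pos-* p g)) (trans (cong +_ pg≡) (pos-sum-* x a))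

    p∣∑xt : + p ℤ∣.∣ sumℤ (λ i → + x i * t i)
    -- By `sum-residues`, `+ p * + g` is a multiple of `p` plus the sum in question.
    p∣∑xt = ℤ∣.∣m+n∣m⇒∣n
      (subst (+ p ℤ∣.∣_)
        (trans pg≡ℤ (sum-residues (+ p) (λ i → + x i) (λ i → + a i) (λ i → + k i) t a≡pk+t))
        (ℤ∣.∣m⇒∣m*n (+ g) ℤ∣.∣-refl))
      (ℤ∣.∣m⇒∣m*n (sumℤ (λ i → + x i * + k i)) ℤ∣.∣-refl)

  quotient⊆⟨⟩ : ⟨ Entries a ⟩ ÷ p ⊆ ⟨ S ⟩
  quotient⊆⟨⟩ {m} pm∈ with X , pm≡ ← ⟨Entries⟩⊆Combination a pm∈ =
    subst ⟨ S ⟩ (sym m≡Q+g)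
      (+-closed gens
        (sum-closed gens _
          (λ i → *-closed gens (X i / p) (⟨⟩-generator S (inj₁ (i , refl)))))
        (remainder∈⟨⟩ (λ i → X i % p) g (λ i → m%n<n (X i) p) pg≡R))
    where
    gens = ⟨⟩-isSubmonoid S

    Q R : ℕ
    Q = sumℕ (λ i → X i / p ℕ.* a i)
    R = sumℕ (λ i → X i % p ℕ.* a i)

    pm≡pQ+R : p ℕ.* m ≡ p ℕ.* Q ℕ.+ R
    pm≡pQ+R = trans pm≡ (sum-divMod p X a)

    p∣R : p ℕ∣.∣ R
    -- `p` divides both `p ℕ.* m` and `p ℕ.* Q`, hence also their difference `R`.
    p∣R = ℕ∣.∣m+n∣m⇒∣n (subst (p ℕ∣.∣_) pm≡pQ+R (ℕ∣.m∣m*n m)) (ℕ∣.m∣m*n Q)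

    g : ℕ
    g = ℕ∣.quotient p∣R

    pg≡R : p ℕ.* g ≡ R
    pg≡R = sym (ℕ∣.m∣n⇒n≡m*quotient p∣R)

    m≡Q+g : m ≡ Q ℕ.+ g
    m≡Q+g = ℕ.*-cancelˡ-≡ m (Q ℕ.+ g) p (begin
      p ℕ.* m                ≡⟨ pm≡pQ+R ⟩
      p ℕ.* Q ℕ.+ R          ≡⟨ cong (p ℕ.* Q ℕ.+_) pg≡R ⟨
      p ℕ.* Q ℕ.+ p ℕ.* g    ≡⟨ ℕ.*-distribˡ-+ p Q g ⟨
      p ℕ.* (Q ℕ.+ g)        ∎)

-- The generated submonoid lies in the quotient

⟨⟩⊆quotient : ∀ p (a : Vector ℕ n) (t : Vector ℤ n) →
              ⟨ Entries a ∪ Fractions p a t ⟩ ⊆ ⟨ Entries a ⟩ ÷ p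
⟨⟩⊆quotient p a t =
  ⟨⟩-minimal (Entries a ∪ Fractions p a t) (÷-isSubmonoid p gens) [ entry , fraction ]
  where
  gens = ⟨⟩-isSubmonoid (Entries a)

  entry : Entries a ⊆ ⟨ Entries a ⟩ ÷ p
  -- The `p`-fold multiple of an entry is a sum of `p` copies of it.
  entry a∈ = *-closed gens p (⟨⟩-generator (Entries a) a∈)

  fraction : Fractions p a t ⊆ ⟨ Entries a ⟩ ÷ p
  fraction {g} (x , (x-bounds , _) , pg≡) =
    -- Multiplying by `p` clears the denominator. The coefficients `x i` are non-negative integers,
    -- so their absolute values serve as natural coefficients.
    subst ⟨ Entries a ⟩ (sym pg≡ℕ)
      (sum-closed gens _ (λ i → *-closed gens ∣ x i ∣ (⟨⟩-generator (Entries a) (i , refl))))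
    where
    +∣x∣ : ∀ i → + ∣ x i ∣ ≡ x i
    +∣x∣ i = ℤ.0≤i⇒+∣i∣≡i (proj₁ (x-bounds i))

    pg≡ℕ : p ℕ.* g ≡ sumℕ (λ i → ∣ x i ∣ ℕ.* a i)
    pg≡ℕ = ℤ.+-injective (begin
      + (p ℕ.* g)                       ≡⟨ ℤ.pos-* p g ⟩
      + p * + g                         ≡⟨ pg≡ ⟩
      sumℤ (λ i → x i * + a i)          ≡⟨ sumℤ-cong (λ i → cong (_* + a i) (+∣x∣ i)) ⟨
      sumℤ (λ i → + ∣ x i ∣ * + a i)    ≡⟨ pos-sum-* (λ i → ∣ x i ∣) a ⟨
      + sumℕ (λ i → ∣ x i ∣ ℕ.* a i)    ∎)

theorem1p1 : (n p : ℕ) → 2 ℕ.≤ n → 0 ℕ.< p →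
    (a : Vector ℕ n) → (∀ i → 0 ℕ.< a i) → gcdᵛ a ≡ 1 →
    (k : Vector ℕ n) (t : Vector ℤ n) →
    (∀ i → + a i ≡ + p * + k i + t i) →
    (∀ i → 1ℤ ≤ t i × t i ≤ + p - 1ℤ) →
    ⟨ Entries a ⟩ ÷ p ≐ ⟨ Entries a ∪ Fractions p a t ⟩
theorem1p1 n p _ 0<p a _ _ k t a≡pk+t t-bounds =
  quotient⊆⟨⟩ p {{ℕ.>-nonZero 0<p}} a k t a≡pk+t (λ i → proj₁ (t-bounds i)) ,
  ⟨⟩⊆quotient p a t
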